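{- For every constant $\varepsilon$ with $0<\varepsilon\le 1/3$ there is a constant $c_\varepsilon>0$ such that the following holds for all positive integers $n$ and $k$: if there is a $\mathrm{MAJ}_k\circ\mathrm{MAJ}_k$ circuit on the variables $x_1,\dots,x_n$ that computes $\mathrm{MAJ}_n$ correctly on at least a $(1-\varepsilon)$ fraction of all $2^n$ inputs, then $k\ge c_\varepsilon\, n^{1/2}$.
   Context: $\mathrm{MAJ}_n(x_1,\dots,x_n)=1$ if $\sum_{i=1}^n x_i\ge n/2$, and $0$ otherwise. For a positive integer $k$, a $\mathrm{MAJ}_k\circ\mathrm{MAJ}_k$ circuit on $x_1,\dots,x_n$ is a depth two formula with a single top gate whose inputs are bottom-level gates, the inputs of each bottom-level gate being variables among $x_1,\dots,x_n$. Every gate (top and bottom) is a threshold gate: with inputs $z_1,\dots,z_r$ it outputs $1$ if $\sum_i c_i z_i\ge t$ and $0$ otherwise, where the weights $c_i$ are positive integers with $\sum_i c_i\le k$ and $t$ is an arbitrary integer threshold (weights and thresholds may differ from gate to gate). A weight $c_i$ can equivalently be seen as repeating the input $z_i$ $c_i$ times. -}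

module Defs where

import Algebra.Properties.Group
open import Data.Bool using (Bool; true; false; if_then_else_)
import Data.Bool.Properties as Bool
open import Data.Fin using (Fin)
open import Data.Integer as ℤ using (ℤ)
open import Data.List as List using (List; _∷_; [])
open import Data.Nat as ℕ using (ℕ; zero; suc)
import Data.Nat.Properties as ℕ
open import Data.Product using (∃; _×_; _,_)
open import Data.Rational as ℚ using (ℚ; 1ℚ)
import Data.Rational.Properties as ℚ
open import Data.Sum using (_⊎_; inj₁; inj₂)
import Data.Sum as Sum
open import Data.Vec as Vec using (Vec; []; _∷_)
open import Data.Vec.Relation.Unary.All using (All)
open import Relation.Binary.PropositionalEquality
open import Relation.Nullary.Decidable using (yes; no; ⌊_⌋)

-- Two-sided Dedekind cuts of ℚ.

record ℝ : Set₁ where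
  field
    lower upper     : ℚ → Set
    lower-inhabited : ∃ lower
    upper-inhabited : ∃ upper
    lower-closed    : ∀ {p q} → p ℚ.< q → lower q → lower p
    upper-closed    : ∀ {p q} → p ℚ.< q → upper p → upper q
    lower-open      : ∀ {p} → lower p → ∃ λ q → p ℚ.< q × lower q
    upper-open      : ∀ {q} → upper q → ∃ λ p → p ℚ.< q × upper p
    disjoint        : ∀ {p q} → lower p → upper q → p ℚ.< q
    located         : ∀ {p q} → p ℚ.< q → lower p ⊎ upper q

open ℝ public

infix 4 _<ℝ_ _≤ℝ_

_<ℝ_ : ℝ → ℝ → Set
x <ℝ y = ∃ λ q → upper x q × lower y q

_≤ℝ_ : ℝ → ℝ → Set
x ≤ℝ y = ∀ q → lower x q → lower y q

fromℚ : ℚ → ℝ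
fromℚ r = record
  { lower           = ℚ._< r
  ; upper           = r ℚ.<_
  ; lower-inhabited = r ℚ.- 1ℚ , below
  ; upper-inhabited = r ℚ.+ 1ℚ , above
  ; lower-closed    = ℚ.<-trans
  ; upper-closed    = λ p<q r<p → ℚ.<-trans r<p p<q
  ; lower-open      = ℚ.<-dense
  ; upper-open      = λ r<q → let m , r<m , m<q = ℚ.<-dense r<q in m , m<q , r<m
  ; disjoint        = ℚ.<-trans
  ; located         = loc
  }
  where
  below : r ℚ.- 1ℚ ℚ.< r
  below = subst (r ℚ.- 1ℚ ℚ.<_) (ℚ.+-identityʳ r)
            (ℚ.+-monoʳ-< r (ℚ.negative⁻¹ (ℚ.- 1ℚ)))

  above : r ℚ.< r ℚ.+ 1ℚ
  above = subst (ℚ._< r ℚ.+ 1ℚ) (ℚ.+-identityʳ r)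
            (ℚ.+-monoʳ-< r (ℚ.positive⁻¹ 1ℚ))

  loc : ∀ {p q} → p ℚ.< q → p ℚ.< r ⊎ r ℚ.< q
  loc {p} p<q with p ℚ.<? r
  ... | yes p<r = inj₁ p<r
  ... | no  p≮r = inj₂ (ℚ.≤-<-trans (ℚ.≮⇒≥ p≮r) p<q)

infixl 6 _⊖_

_⊖_ : ℚ → ℝ → ℝ
r ⊖ x = record
  { lower           = λ q → upper x (r ℚ.- q)
  ; upper           = λ q → lower x (r ℚ.- q)
  ; lower-inhabited = let q , u = upper-inhabited x in
                      r ℚ.- q , subst (upper x) (sym (flip² q)) u
  ; upper-inhabited = let q , l = lower-inhabited x in
                      r ℚ.- q , subst (lower x) (sym (flip² q)) l
  ; lower-closed    = λ p<q → upper-closed x (flip-< p<q)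
  ; upper-closed    = λ p<q → lower-closed x (flip-< p<q)
  ; lower-open      = λ {p} u → let s , s<r-p , us = upper-open x u in
                      r ℚ.- s ,
                      subst (ℚ._< r ℚ.- s) (flip² p) (flip-< s<r-p) ,
                      subst (upper x) (sym (flip² s)) us
  ; upper-open      = λ {q} l → let s , r-q<s , ls = lower-open x l in
                      r ℚ.- s ,
                      subst (r ℚ.- s ℚ.<_) (flip² q) (flip-< r-q<s) ,
                      subst (lower x) (sym (flip² s)) ls
  ; disjoint        = λ {p} {q} u l →
                      subst₂ ℚ._<_ (flip² p) (flip² q) (flip-< (disjoint x l u))
  ; located         = λ p<q → Sum.swap (located x (flip-< p<q))
  }
  where
  flip-< : ∀ {p q} → p ℚ.< q → r ℚ.- q ℚ.< r ℚ.- p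
  flip-< p<q = ℚ.+-monoʳ-< r (ℚ.neg-antimono-< p<q)

  flip² : ∀ q → r ℚ.- (r ℚ.- q) ≡ q
  flip² q = begin
    r ℚ.- (r ℚ.- q)                  ≡⟨ cong (r ℚ.+_) (ℚ.neg-distrib-+ r (ℚ.- q)) ⟩
    r ℚ.+ (ℚ.- r ℚ.+ ℚ.- (ℚ.- q))    ≡⟨ ℚ.+-assoc r (ℚ.- r) _ ⟨
    (r ℚ.- r) ℚ.+ ℚ.- (ℚ.- q)        ≡⟨ cong₂ ℚ._+_ (ℚ.+-inverseʳ r) (⁻¹-involutive q) ⟩
    ℚ.0ℚ ℚ.+ q                       ≡⟨ ℚ.+-identityˡ q ⟩
    q                                ∎
    where
    open ≡-Reasoning
    open Algebra.Properties.Group ℚ.+-0-group using (⁻¹-involutive)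

bit : Bool → ℕ
bit b = if b then 1 else 0

-- The condition ∑ xᵢ ≥ n/2 with the denominator cleared.

MAJ : ∀ n → Vec Bool n → Bool
MAJ n x = ⌊ n ℕ.≤? 2 ℕ.* Vec.sum (Vec.map bit x) ⌋

-- A threshold gate with inputs from I; the same input may be listed repeatedly.

record Gate (k : ℕ) (I : Set) : Set where
  field
    {fanIn}          : ℕ
    inputs           : Vec I fanIn
    weights          : Vec ℕ fanIn
    weights-positive : All (0 ℕ.<_) weights
    weights-bounded  : Vec.sum weights ℕ.≤ k
    threshold        : ℤ

evalGate : ∀ {k I} → Gate k I → (I → Bool) → Bool
evalGate G v = ⌊ threshold ℤ.≤? ℤ.+ Vec.sum (Vec.zipWith (λ c z → c ℕ.* bit (v z)) weights inputs) ⌋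
  where open Gate G

-- MAJₖ ∘ MAJₖ circuits on n variables.

Circuit : ℕ → ℕ → Set
Circuit k n = Gate k (Gate k (Fin n))

evalCircuit : ∀ {k n} → Circuit k n → Vec Bool n → Bool
evalCircuit C x = evalGate C (λ G → evalGate G (Vec.lookup x))

-- Every vector of {0,1}ⁿ occurs exactly once.

allInputs : ∀ n → List (Vec Bool n)
allInputs zero    = [] ∷ []
allInputs (suc n) = List.cartesianProductWith _∷_ (false ∷ true ∷ []) (allInputs n)

agreement : ∀ {n} → (Vec Bool n → Bool) → (Vec Bool n → Bool) → ℚ
agreement {n} f g =
  (ℤ.+ List.length (List.filter (λ x → f x Bool.≟ g x) (allInputs n)) ℚ./ (2 ℕ.^ n))
    {{ℕ.m^n≢0 2 n}}

{-# OPTIONS --safe #-}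
module Submission where

-- A MAJₖ ∘ MAJₖ circuit reads at most k² variables, so it suffices that a junta on m of the
-- n variables agrees with MAJₙ on a 2/3 fraction of the inputs only if n + 1 ≤ 9 (m + 1).
-- Its correlation with MAJₙ is at most the L² norm of the conditional expectation of the
-- majority (as a sign) given the m variables. For a symmetric function the square vₘ of
-- that norm depends only on m and is convex in m, with vₙ = 1. For majority v₀ ≤ v₁ - v₀,
-- since the conditional expectations given the two values of one variable have opposite
-- signs. Convexity then gives (n + 1) vₘ ≤ m + 1.

open import Data.Bool using (Bool; true; false; _≟_)
open import Data.Empty as Empty using (⊥-elim)
open import Data.Fin using (Fin; zero; suc)
open import Data.Fin.Subset using (Subset; inside; outside; _∈_; _∪_; ⁅_⁆; ⊥; ∁; ∣_∣)
open import Data.Fin.Subset.Properties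
  using (∣⊥∣≡0; ∣⁅x⁆∣≡1; ∣p∣≤n; ∣∁p∣≡n∸∣p∣; p⊆p∪q; q⊆p∪q; x∈⁅x⁆)
open import Data.Integer as ℤ using (ℤ; +_; _+_; _*_; _-_; -_; _≤_; 0ℤ; 1ℤ; -1ℤ)
import Data.Integer.Properties as ℤ
open import Data.Integer.Tactic.RingSolver using (solve-∀)
open import Data.List as List using (List; []; _∷_; _++_)
import Data.List.Properties as List
open import Data.Nat as ℕ using (ℕ; zero; suc)
import Data.Nat.Properties as ℕ
import Data.Nat.Tactic.RingSolver as ℕ-Solver
open import Data.Product using (∃; _×_; _,_)
open import Data.Rational as ℚ using (ℚ; 0ℚ; 1ℚ)
import Data.Rational.Properties as ℚ
open import Data.Rational.Unnormalised as ℚᵘ using (mkℚᵘ; *≤*)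
import Data.Rational.Unnormalised.Properties as ℚᵘ
open import Data.Sum using (_⊎_; inj₁; inj₂)
open import Data.Vec as Vec using (Vec; []; _∷_; lookup; there)
open import Data.Vec.Relation.Unary.All using (All; []; _∷_)
open import Function using (_∘_)
open import Relation.Binary.PropositionalEquality
open import Relation.Nullary.Decidable using (yes; no; ⌊_⌋)
open import Relation.Unary using (Decidable)
open import Defs

private variable
  k m n r : ℕ

-- Shift sums and energies of a symmetric function.

Δ : (ℕ → ℤ) → ℕ → ℤ
Δ h a = h a - h (suc a)

-- The sum of h (a + |z|) over z ∈ {0,1}ʳ, where |z| is the Hamming weight.
shiftSum : ℕ → (ℕ → ℤ) → ℕ → ℤ
shiftSum zero    h a = h a
shiftSum (suc r) h a = shiftSum r h a + shiftSum r h (suc a)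

-- 2ᵐ times the sum of (shiftSum r h (a + |y|))² over y ∈ {0,1}ᵐ. The factor makes it 4ᵐ⁺ʳ vₘ.
energy : ℕ → ℕ → (ℕ → ℤ) → ℕ → ℤ
energy zero    r h a = shiftSum r h a * shiftSum r h a
energy (suc m) r h a = + 2 * (energy m r h a + energy m r h (suc a))

square-nonneg : ∀ x → 0ℤ ≤ x * x
square-nonneg (+ zero)   = ℤ.≤-refl
square-nonneg (+ suc _)  = ℤ.+≤+ ℕ.z≤n
square-nonneg ℤ.-[1+ _ ] = ℤ.+≤+ ℕ.z≤n

square-mono : ∀ {x y} → 0ℤ ≤ x → x ≤ y → x * x ≤ y * y
square-mono {+ x} {+ y} _ (ℤ.+≤+ x≤y) =
  subst₂ _≤_ (ℤ.pos-* x x) (ℤ.pos-* y y) (ℤ.+≤+ (ℕ.*-mono-≤ x≤y x≤y))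

energy-nonneg : ∀ m r h a → 0ℤ ≤ energy m r h a
energy-nonneg zero    r h a = square-nonneg (shiftSum r h a)
energy-nonneg (suc m) r h a =
  ℤ.*-monoˡ-≤-nonNeg (+ 2)
    (ℤ.+-mono-≤ (energy-nonneg m r h a) (energy-nonneg m r h (suc a)))

shiftSum-Δ : ∀ r h a → shiftSum r (Δ h) a ≡ shiftSum r h a - shiftSum r h (suc a)
shiftSum-Δ zero    h a = refl
shiftSum-Δ (suc r) h a
  rewrite shiftSum-Δ r h a | shiftSum-Δ r h (suc a) =
  regroup (shiftSum r h a) (shiftSum r h (suc a)) (shiftSum r h (suc (suc a)))
  where
  regroup : ∀ x y z → (x - y) + (y - z) ≡ (x + y) - (y + z)
  regroup = solve-∀

shiftSum-suc : ∀ r h a →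
  shiftSum r (λ b → h b + h (suc b)) a ≡ shiftSum (suc r) h a
shiftSum-suc zero    h a = refl
shiftSum-suc (suc r) h a = cong₂ _+_ (shiftSum-suc r h a) (shiftSum-suc r h (suc a))

shiftSum-neg : ∀ r h a → shiftSum r (λ b → - h b) a ≡ - shiftSum r h a
shiftSum-neg zero    h a = refl
shiftSum-neg (suc r) h a
  rewrite shiftSum-neg r h a | shiftSum-neg r h (suc a) =
  sym (ℤ.neg-distrib-+ (shiftSum r h a) _)

-- Complementing `z` turns weight `|z|` into `r - |z|`, so the arguments `a + |z|` and `b + r - |z|`
-- are paired, and they always add up to `r + (a + b)`.
shiftSum-reflect : ∀ r {f g : ℕ → ℤ} {a b} →
  (∀ i j → i ℕ.+ j ≡ r ℕ.+ (a ℕ.+ b) → f i ≤ g j) → shiftSum r f a ≤ shiftSum r g b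
shiftSum-reflect zero f≤g = f≤g _ _ refl
shiftSum-reflect (suc r) {f} {g} {a} {b} f≤g = begin
  shiftSum r f a + shiftSum r f (suc a)
    ≤⟨ ℤ.+-mono-≤
         (shiftSum-reflect r λ i j eq → f≤g i j
           (trans eq (trans (cong (r ℕ.+_) (ℕ.+-suc a b)) (ℕ.+-suc r _))))
         (shiftSum-reflect r λ i j eq → f≤g i j (trans eq (ℕ.+-suc r _))) ⟩
  shiftSum r g (suc b) + shiftSum r g b
    ≡⟨ ℤ.+-comm (shiftSum r g (suc b)) _ ⟩
  shiftSum r g b + shiftSum r g (suc b) ∎
  where open ℤ.≤-Reasoning

-- A variable that is averaged out can be summed into `h` beforehand.
energy-suc : ∀ m r h a →
  energy m r (λ b → h b + h (suc b)) a ≡ energy m (suc r) h a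
energy-suc zero    r h a = cong (λ x → x * x) (shiftSum-suc r h a)
energy-suc (suc m) r h a =
  cong (+ 2 *_) (cong₂ _+_ (energy-suc m r h a) (energy-suc m r h (suc a)))

-- The parallelogram law.
energy-increment : ∀ m r h a →
  energy (suc m) r h a ≡ energy m (suc r) h a + energy m r (Δ h) a
energy-increment zero    r h a rewrite shiftSum-Δ r h a =
  parallelogram (shiftSum r h a) (shiftSum r h (suc a))
  where
  parallelogram : ∀ x y →
    + 2 * (x * x + y * y) ≡ (x + y) * (x + y) + (x - y) * (x - y)
  parallelogram = solve-∀
energy-increment (suc m) r h a =
  trans (cong (+ 2 *_) (cong₂ _+_ (energy-increment m r h a) (energy-increment m r h (suc a))))
        (regroup (energy m (suc r) h a) _ _ _)
  where
  regroup : ∀ p q p′ q′ →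
    + 2 * ((p + q) + (p′ + q′)) ≡ + 2 * (p + p′) + + 2 * (q + q′)
  regroup = solve-∀

-- Both sides carry the same power of 4, so this is vₘ ≤ vₘ₊₁: the increment is the energy of `Δ h`,
-- a sum of squares. Applied to `Δ h` itself, it becomes the convexity of v.
energy-mono : ∀ m r h a → energy m (suc r) h a ≤ energy (suc m) r h a
energy-mono m r h a = begin
  energy m (suc r) h a                       ≡⟨ ℤ.+-identityʳ _ ⟨
  energy m (suc r) h a + 0ℤ                  ≤⟨ ℤ.+-monoʳ-≤ (energy m (suc r) h a) (energy-nonneg m r (Δ h) a) ⟩
  energy m (suc r) h a + energy m r (Δ h) a  ≡⟨ energy-increment m r h a ⟨
  energy (suc m) r h a                       ∎
  where open ℤ.≤-Reasoning

-- Convexity of the energy in the number of read variables.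

-- There are N + 1 variables in all. By `energy-increment`, the hypothesis is v₀ ≤ v₁ - v₀
-- multiplied by 4 to the power N + 1.
module _ (h : ℕ → ℤ) (N : ℕ) (bias≤influence : energy 0 (suc N) h 0 ≤ energy 0 N (Δ h) 0) where

  -- The increments energy m r (Δ h) grow with m, being energies themselves.
  energy≤increment : ∀ m r → m ℕ.+ r ≡ N →
    energy m (suc r) h 0 ≤ + suc m * energy m r (Δ h) 0
  energy≤increment zero    r refl =
    ℤ.≤-trans bias≤influence (ℤ.≤-reflexive (sym (ℤ.*-identityˡ (energy 0 r (Δ h) 0))))
  energy≤increment (suc m) r eq = begin
    energy (suc m) (suc r) h 0
      ≡⟨ energy-increment m (suc r) h 0 ⟩
    energy m (suc (suc r)) h 0 + energy m (suc r) (Δ h) 0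
      ≤⟨ ℤ.+-monoˡ-≤ _ (energy≤increment m (suc r) (trans (ℕ.+-suc m r) eq)) ⟩
    + suc m * energy m (suc r) (Δ h) 0 + energy m (suc r) (Δ h) 0
      ≡⟨ regroup (+ suc m) _ ⟩
    + suc (suc m) * energy m (suc r) (Δ h) 0
      ≤⟨ ℤ.*-monoˡ-≤-nonNeg (+ suc (suc m)) (energy-mono m r (Δ h) 0) ⟩
    + suc (suc m) * energy (suc m) r (Δ h) 0 ∎
    where
    open ℤ.≤-Reasoning
    regroup : ∀ i x → i * x + x ≡ (1ℤ + i) * x
    regroup = solve-∀

  -- Adding (m + 1) vₘ to vₘ ≤ (m + 1) (vₘ₊₁ - vₘ) shows that vₘ / (m + 1) does not decrease.
  energy-ratio-suc : ∀ m r → m ℕ.+ r ≡ N →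
    + suc (suc m) * energy m (suc r) h 0 ≤ + suc m * energy (suc m) r h 0
  energy-ratio-suc m r eq = begin
    + suc (suc m) * energy m (suc r) h 0
      ≡⟨ split (+ suc m) _ ⟩
    + suc m * energy m (suc r) h 0 + energy m (suc r) h 0
      ≤⟨ ℤ.+-monoʳ-≤ (+ suc m * energy m (suc r) h 0) (energy≤increment m r eq) ⟩
    + suc m * energy m (suc r) h 0 + + suc m * energy m r (Δ h) 0
      ≡⟨ ℤ.*-distribˡ-+ (+ suc m) (energy m (suc r) h 0) _ ⟨
    + suc m * (energy m (suc r) h 0 + energy m r (Δ h) 0)
      ≡⟨ cong (+ suc m *_) (energy-increment m r h 0) ⟨
    + suc m * energy (suc m) r h 0 ∎
    where
    open ℤ.≤-Reasoning
    split : ∀ i x → (1ℤ + i) * x ≡ i * x + x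
    split = solve-∀

  energy-ratio : ∀ m r → m ℕ.+ r ≡ suc N →
    + suc (suc N) * energy m r h 0 ≤ + suc m * energy (suc N) 0 h 0
  -- Here `m` is `suc N`, and the two sides coincide.
  energy-ratio m zero    eq rewrite trans (sym (ℕ.+-identityʳ m)) eq = ℤ.≤-refl
  -- The ratios telescope; the common factor m + 2 clears the intermediate denominator.
  energy-ratio m (suc r) eq = ℤ.*-cancelˡ-≤-pos _ _ (+ suc (suc m)) (begin
    + suc (suc m) * (+ suc (suc N) * energy m (suc r) h 0)
      ≡⟨ swap (+ suc (suc m)) (+ suc (suc N)) (energy m (suc r) h 0) ⟩
    + suc (suc N) * (+ suc (suc m) * energy m (suc r) h 0)
      ≤⟨ ℤ.*-monoˡ-≤-nonNeg (+ suc (suc N)) (energy-ratio-suc m r (ℕ.suc-injective eq′)) ⟩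
    + suc (suc N) * (+ suc m * energy (suc m) r h 0)
      ≡⟨ swap (+ suc (suc N)) (+ suc m) (energy (suc m) r h 0) ⟩
    + suc m * (+ suc (suc N) * energy (suc m) r h 0)
      ≤⟨ ℤ.*-monoˡ-≤-nonNeg (+ suc m) (energy-ratio (suc m) r eq′) ⟩
    + suc m * (+ suc (suc m) * energy (suc N) 0 h 0)
      ≡⟨ swap (+ suc m) (+ suc (suc m)) (energy (suc N) 0 h 0) ⟩
    + suc (suc m) * (+ suc m * energy (suc N) 0 h 0) ∎)
    where
    open ℤ.≤-Reasoning
    eq′ : suc (m ℕ.+ r) ≡ suc N
    eq′ = trans (sym (ℕ.+-suc m r)) eq
    swap : ∀ x y z → x * (y * z) ≡ y * (x * z)
    swap = solve-∀

-- Correlation of a junta with a symmetric function.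

sgn : Bool → ℤ
sgn false = -1ℤ
sgn true  = 1ℤ

sgn² : ∀ b → sgn b * sgn b ≡ 1ℤ
sgn² false = refl
sgn² true  = refl

-- An unnormalised inner product over the cube. The offset `a` counts the ones already fixed, which
-- keeps restrictions to subcubes in the same form.
correlation : (Vec Bool n → Bool) → (ℕ → ℤ) → ℕ → ℤ
correlation {zero}  f h a = sgn (f []) * h a
correlation {suc n} f h a =
  correlation (f ∘ (false ∷_)) h a + correlation (f ∘ (true ∷_)) h (suc a)

correlation-cong : {f g : Vec Bool n → Bool} → (∀ x → f x ≡ g x) →
  ∀ h a → correlation f h a ≡ correlation g h a
correlation-cong {zero}  f≗g h a = cong (λ b → sgn b * h a) (f≗g [])
correlation-cong {suc n} f≗g h a =
  cong₂ _+_ (correlation-cong (f≗g ∘ (false ∷_)) h a)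
            (correlation-cong (f≗g ∘ (true ∷_)) h (suc a))

correlation-suc : ∀ (f : Vec Bool n → Bool) h a →
  correlation f h a + correlation f h (suc a) ≡ correlation f (λ b → h b + h (suc b)) a
correlation-suc {zero}  f h a = sym (ℤ.*-distribˡ-+ (sgn (f [])) (h a) _)
correlation-suc {suc n} f h a =
  trans (regroup (correlation (f ∘ (false ∷_)) h a) _ _ _)
        (cong₂ _+_ (correlation-suc (f ∘ (false ∷_)) h a)
                   (correlation-suc (f ∘ (true ∷_)) h (suc a)))
  where
  regroup : ∀ p q r s → (p + q) + (r + s) ≡ (p + r) + (q + s)
  regroup = solve-∀

DependsOn : Subset n → (Vec Bool n → Bool) → Set
DependsOn p f = ∀ x y → (∀ {i} → i ∈ p → lookup x i ≡ lookup y i) → f x ≡ f y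

lookup-∷ : ∀ {b s} {p : Subset n} {x y : Vec Bool n} →
  (∀ {i} → i ∈ p → lookup x i ≡ lookup y i) →
  ∀ {i} → i ∈ s ∷ p → lookup (b ∷ x) i ≡ lookup (b ∷ y) i
lookup-∷ x≡y {zero}  _               = refl
lookup-∷ x≡y {suc _} (there i∈p) = x≡y i∈p

-- This is Cauchy-Schwarz over the assignments to the read variables, done one variable at a time:
-- each variable in `p` costs the factor 2 built into `energy`, and each variable outside `p` is
-- absorbed into `h`.
correlation²≤energy : (p : Subset n) {f : Vec Bool n → Bool} → DependsOn p f →
  ∀ h a → correlation f h a * correlation f h a ≤ (energy ∣ p ∣ ∣ ∁ p ∣) h a
correlation²≤energy [] {f} _ h a = ℤ.≤-reflexive (begin
  (sgn (f []) * h a) * (sgn (f []) * h a)  ≡⟨ regroup (sgn (f [])) (h a) ⟩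
  (sgn (f []) * sgn (f [])) * (h a * h a)  ≡⟨ cong (_* (h a * h a)) (sgn² (f [])) ⟩
  1ℤ * (h a * h a)                         ≡⟨ ℤ.*-identityˡ _ ⟩
  h a * h a                                ∎)
  where
  open ≡-Reasoning
  regroup : ∀ x y → (x * y) * (x * y) ≡ (x * x) * (y * y)
  regroup = solve-∀
correlation²≤energy (inside ∷ p) {f} dep h a = begin
  (c₀ + c₁) * (c₀ + c₁)                          ≡⟨ ℤ.+-identityʳ _ ⟨
  (c₀ + c₁) * (c₀ + c₁) + 0ℤ                     ≤⟨ ℤ.+-monoʳ-≤ ((c₀ + c₁) * (c₀ + c₁)) (square-nonneg (c₀ - c₁)) ⟩
  (c₀ + c₁) * (c₀ + c₁) + (c₀ - c₁) * (c₀ - c₁)  ≡⟨ parallelogram c₀ c₁ ⟩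
  + 2 * (c₀ * c₀ + c₁ * c₁)
    ≤⟨ ℤ.*-monoˡ-≤-nonNeg (+ 2) (ℤ.+-mono-≤
         (correlation²≤energy p (restrict false) h a)
         (correlation²≤energy p (restrict true) h (suc a))) ⟩
  + 2 * ((energy ∣ p ∣ ∣ ∁ p ∣) h a + (energy ∣ p ∣ ∣ ∁ p ∣) h (suc a)) ∎
  where
  open ℤ.≤-Reasoning
  c₀ c₁ : ℤ
  c₀ = correlation (f ∘ (false ∷_)) h a
  c₁ = correlation (f ∘ (true ∷_)) h (suc a)
  parallelogram : ∀ x y → (x + y) * (x + y) + (x - y) * (x - y) ≡ + 2 * (x * x + y * y)
  parallelogram = solve-∀
  restrict : ∀ b → DependsOn p (f ∘ (b ∷_))
  restrict b x y x≡y = dep (b ∷ x) (b ∷ y) (lookup-∷ x≡y)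
correlation²≤energy (outside ∷ p) {f} dep h a = begin
  c * c                                               ≡⟨ cong (λ z → z * z) c≡ ⟩
  c′ * c′                                             ≤⟨ correlation²≤energy p restrict _ a ⟩
  (energy ∣ p ∣ ∣ ∁ p ∣) (λ b → h b + h (suc b)) a      ≡⟨ energy-suc ∣ p ∣ ∣ ∁ p ∣ h a ⟩
  (energy ∣ p ∣ (suc ∣ ∁ p ∣)) h a                      ∎
  where
  open ℤ.≤-Reasoning
  c c′ : ℤ
  c  = correlation f h a
  c′ = correlation (f ∘ (false ∷_)) (λ b → h b + h (suc b)) a
  restrict : DependsOn p (f ∘ (false ∷_))
  restrict x y x≡y = dep (false ∷ x) (false ∷ y) (lookup-∷ x≡y)
  ignore : ∀ x → f (true ∷ x) ≡ f (false ∷ x)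
  ignore x = dep (true ∷ x) (false ∷ x) unread
    where
    unread : ∀ {i} → i ∈ outside ∷ p → lookup (true ∷ x) i ≡ lookup (false ∷ x) i
    unread (there _) = refl
  c≡ : c ≡ c′
  c≡ = trans
    -- The two halves see the same function, so they differ only in the shift of `h`.
    (cong (λ z → correlation (f ∘ (false ∷_)) h a + z) (correlation-cong ignore h (suc a)))
    (correlation-suc (f ∘ (false ∷_)) h a)

-- Counting agreements through correlation.

weight : Vec Bool n → ℕ
weight x = Vec.sum (Vec.map bit x)

filter-map-length : ∀ {A B : Set} {P : B → Set} (P? : Decidable P) (c : A → B) xs →
  List.length (List.filter P? (List.map c xs)) ≡ List.length (List.filter (P? ∘ c) xs)
filter-map-length P? c []       = refl
filter-map-length P? c (x ∷ xs) with P? (c x)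
... | yes _ = cong suc (filter-map-length P? c xs)
... | no  _ = filter-map-length P? c xs

agreements : (f g : Vec Bool n → Bool) → ℕ
agreements {n} f g = List.length (List.filter (λ x → f x ≟ g x) (allInputs n))

agreements-suc : (f g : Vec Bool (suc n) → Bool) →
  agreements f g ≡ agreements (f ∘ (false ∷_)) (g ∘ (false ∷_)) ℕ.+
                   agreements (f ∘ (true ∷_)) (g ∘ (true ∷_))
agreements-suc {n} f g = begin
  List.length (List.filter P? (xs₀ ++ (xs₁ ++ [])))
    ≡⟨ cong (λ ys → List.length (List.filter P? (xs₀ ++ ys))) (List.++-identityʳ xs₁) ⟩
  List.length (List.filter P? (xs₀ ++ xs₁))
    ≡⟨ cong List.length (List.filter-++ P? xs₀ xs₁) ⟩
  List.length (List.filter P? xs₀ ++ List.filter P? xs₁)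
    ≡⟨ List.length-++ (List.filter P? xs₀) ⟩
  List.length (List.filter P? xs₀) ℕ.+ List.length (List.filter P? xs₁)
    ≡⟨ cong₂ ℕ._+_ (filter-map-length P? (false ∷_) (allInputs n))
                   (filter-map-length P? (true ∷_) (allInputs n)) ⟩
  _ ∎
  where
  open ≡-Reasoning
  P? = λ x → f x ≟ g x
  xs₀ xs₁ : List (Vec Bool (suc n))
  xs₀ = List.map (false ∷_) (allInputs n)
  xs₁ = List.map (true ∷_) (allInputs n)

-- Each input `x` contributes 1 + `sgn (f x) * sgn (g x)`, which is 2 on agreement and 0 otherwise.
2*agreements : (f g : Vec Bool n → Bool) (h : ℕ → ℤ) (a : ℕ) →
  (∀ x → h (a ℕ.+ weight x) ≡ sgn (g x)) →
  + 2 * + agreements f g ≡ + (2 ℕ.^ n) + correlation f h a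
2*agreements {zero} f g h a h≡g
  rewrite trans (cong h (sym (ℕ.+-identityʳ a))) (h≡g [])
  with f [] | g []
... | false | false = refl
... | false | true  = refl
... | true  | false = refl
... | true  | true  = refl
2*agreements {suc n} f g h a h≡g = begin
  + 2 * + agreements f g
    ≡⟨ cong (λ z → + 2 * + z) (agreements-suc f g) ⟩
  + 2 * (+ A₀ + + A₁)
    ≡⟨ ℤ.*-distribˡ-+ (+ 2) (+ A₀) (+ A₁) ⟩
  + 2 * + A₀ + + 2 * + A₁
    ≡⟨ cong₂ _+_ (2*agreements (f ∘ (false ∷_)) (g ∘ (false ∷_)) h a (h≡g ∘ (false ∷_)))
                 (2*agreements (f ∘ (true ∷_)) (g ∘ (true ∷_)) h (suc a)
                   λ x → trans (cong h (sym (ℕ.+-suc a (weight x)))) (h≡g (true ∷ x))) ⟩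
  (+ N + c₀) + (+ N + c₁)
    ≡⟨ regroup (+ N) c₀ c₁ ⟩
  (+ N + (+ N + 0ℤ)) + (c₀ + c₁) ∎
  where
  open ≡-Reasoning
  N A₀ A₁ : ℕ
  N  = 2 ℕ.^ n
  A₀ = agreements (f ∘ (false ∷_)) (g ∘ (false ∷_))
  A₁ = agreements (f ∘ (true ∷_)) (g ∘ (true ∷_))
  c₀ c₁ : ℤ
  c₀ = correlation (f ∘ (false ∷_)) h a
  c₁ = correlation (f ∘ (true ∷_)) h (suc a)
  regroup : ∀ x y z → (x + y) + (x + z) ≡ (x + (x + 0ℤ)) + (y + z)
  regroup = solve-∀

-- Bias and influence of majority.

majSign : ℕ → ℕ → ℤ
majSign n w = sgn ⌊ n ℕ.≤? 2 ℕ.* w ⌋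

-- No variable is averaged out, so every term is the square of a sign. For `m` equal to `n` and `a`
-- zero this is vₙ = 1.
energy-majSign : ∀ n m a → energy m 0 (majSign n) a ≡ + (2 ℕ.^ m) * + (2 ℕ.^ m)
energy-majSign n zero    a = sgn² ⌊ n ℕ.≤? 2 ℕ.* a ⌋
energy-majSign n (suc m) a
  rewrite energy-majSign n m a | energy-majSign n m (suc a) = regroup (+ (2 ℕ.^ m))
  where
  regroup : ∀ x → + 2 * (x * x + x * x) ≡ (x + (x + 0ℤ)) * (x + (x + 0ℤ))
  regroup = solve-∀

-- Two weights that both reach n/2 add up to at least `n`. Ties count as majority, whence the strict
-- inequality here and the weak one in `majSign-above`.
majSign-below : ∀ n i j → i ℕ.+ j ℕ.< n → majSign n i ≤ - majSign n j
majSign-below n i j i+j<n with n ℕ.≤? 2 ℕ.* i | n ℕ.≤? 2 ℕ.* j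
... | no _ | no _  = ℤ.-≤+
... | no _ | yes _ = ℤ.≤-refl
... | yes _ | no _ = ℤ.≤-refl
... | yes p | yes q = ⊥-elim (ℕ.<-irrefl refl (begin-strict
  2 ℕ.* (i ℕ.+ j)          <⟨ ℕ.*-monoʳ-< 2 i+j<n ⟩
  2 ℕ.* n                  ≡⟨ cong (n ℕ.+_) (ℕ.+-identityʳ n) ⟩
  n ℕ.+ n                  ≤⟨ ℕ.+-mono-≤ p q ⟩
  2 ℕ.* i ℕ.+ 2 ℕ.* j      ≡⟨ ℕ.*-distribˡ-+ 2 i j ⟨
  2 ℕ.* (i ℕ.+ j)          ∎))
  where open ℕ.≤-Reasoning

majSign-above : ∀ n i j → n ℕ.≤ i ℕ.+ j → - majSign n i ≤ majSign n j
majSign-above n i j n≤i+j with n ℕ.≤? 2 ℕ.* i | n ℕ.≤? 2 ℕ.* j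
... | yes _ | yes _ = ℤ.-≤+
... | no _ | yes _  = ℤ.≤-refl
... | yes _ | no _  = ℤ.≤-refl
... | no p | no q = ⊥-elim (ℕ.<-irrefl refl (begin-strict
  2 ℕ.* (i ℕ.+ j)          ≡⟨ ℕ.*-distribˡ-+ 2 i j ⟩
  2 ℕ.* i ℕ.+ 2 ℕ.* j      <⟨ ℕ.+-mono-< (ℕ.≰⇒> p) (ℕ.≰⇒> q) ⟩
  n ℕ.+ n                  ≡⟨ cong (n ℕ.+_) (ℕ.+-identityʳ n) ⟨
  2 ℕ.* n                  ≤⟨ ℕ.*-monoʳ-≤ 2 n≤i+j ⟩
  2 ℕ.* (i ℕ.+ j)          ∎))
  where open ℕ.≤-Reasoning

≤-neg⇒nonpos : ∀ {x} → x ≤ - x → x ≤ 0ℤ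
≤-neg⇒nonpos {+ zero}     _  = ℤ.≤-refl
≤-neg⇒nonpos {+ suc _}    ()
≤-neg⇒nonpos {ℤ.-[1+ _ ]} _  = ℤ.-≤+

neg-≤⇒nonneg : ∀ {x} → - x ≤ x → 0ℤ ≤ x
neg-≤⇒nonneg {+ _}        _  = ℤ.+≤+ ℕ.z≤n
neg-≤⇒nonneg {ℤ.-[1+ _ ]} ()

square-opposite : ∀ {x y} → x ≤ 0ℤ → 0ℤ ≤ y → (x + y) * (x + y) ≤ (x - y) * (x - y)
square-opposite {x} {+ y} x≤0 _ = begin
  (x + + y) * (x + + y)                       ≡⟨ expand x (+ y) ⟩
  (x - + y) * (x - + y) + + 4 * (x * + y)     ≤⟨ ℤ.+-monoʳ-≤ ((x - + y) * (x - + y))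
                                                    (ℤ.*-monoˡ-≤-nonNeg (+ 4) (ℤ.*-monoʳ-≤-nonNeg (+ y) x≤0)) ⟩
  (x - + y) * (x - + y) + + 4 * (0ℤ * + y)    ≡⟨ ℤ.+-identityʳ _ ⟩
  (x - + y) * (x - + y)                       ∎
  where
  open ℤ.≤-Reasoning
  expand : ∀ x y → (x + y) * (x + y) ≡ (x - y) * (x - y) + + 4 * (x * y)
  expand = solve-∀

-- Fixing one input to 0 makes the majority lean to 0 and fixing it to 1 makes it lean
-- to 1, so the two halves of the total have opposite signs.
maj-bias≤influence : ∀ n →
  energy 0 (suc n) (majSign (suc n)) 0 ≤ energy 0 n (Δ (majSign (suc n))) 0
maj-bias≤influence n rewrite shiftSum-Δ n (majSign (suc n)) 0 = square-opposite
  -- Each half is compared with its own reflection. Among n + 1 inputs, paired weights add up to n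
  -- when the fixed input is 0, and to n + 2 when it is 1.
  (≤-neg⇒nonpos (subst (shiftSum n h 0 ≤_) (shiftSum-neg n h 0)
    (shiftSum-reflect n λ i j eq → majSign-below (suc n) i j
      (ℕ.s≤s (ℕ.≤-reflexive (trans eq (ℕ.+-identityʳ n)))))))
  (neg-≤⇒nonneg (subst (_≤ shiftSum n h 1) (shiftSum-neg n h 1)
    (shiftSum-reflect n λ i j eq → majSign-above (suc n) i j
      (subst (suc n ℕ.≤_) (sym (trans eq (ℕ.+-comm n 2))) (ℕ.n≤1+n (suc n))))))
  where
  h : ℕ → ℤ
  h = majSign (suc n)

-- Juntas that approximate majority.

∣∁p∣-complement : (p : Subset n) → ∣ p ∣ ℕ.+ ∣ ∁ p ∣ ≡ n
∣∁p∣-complement p = trans (cong (∣ p ∣ ℕ.+_) (∣∁p∣≡n∸∣p∣ p)) (ℕ.m+[n∸m]≡n (∣p∣≤n p))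

-- Divided by `N * N`, the chain is (c/N)² ≤ vₘ ≤ (m + 1)/(n + 2), with m = `∣ p ∣` and n + 1
-- variables in all.
junta-correlation : (p : Subset (suc n)) {f : Vec Bool (suc n) → Bool} → DependsOn p f →
  let c = correlation f (majSign (suc n)) 0
      N = + (2 ℕ.^ suc n)
  in
  + suc (suc n) * (c * c) ≤ + suc ∣ p ∣ * (N * N)
junta-correlation {n} p {f} dep = begin
  + suc (suc n) * (c * c)
    ≤⟨ ℤ.*-monoˡ-≤-nonNeg (+ suc (suc n)) (correlation²≤energy p dep h 0) ⟩
  + suc (suc n) * (energy ∣ p ∣ ∣ ∁ p ∣) h 0
    ≤⟨ energy-ratio h n (maj-bias≤influence n) ∣ p ∣ ∣ ∁ p ∣ (∣∁p∣-complement p) ⟩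
  + suc ∣ p ∣ * energy (suc n) 0 h 0
    ≡⟨ cong (+ suc ∣ p ∣ *_) (energy-majSign (suc n) (suc n) 0) ⟩
  + suc ∣ p ∣ * (+ (2 ℕ.^ suc n) * + (2 ℕ.^ suc n)) ∎
  where
  open ℤ.≤-Reasoning
  h = majSign (suc n)
  c = correlation f h 0

-- Agreement on 2/3 of the inputs means normalised correlation at least 2 · 2/3 - 1 = 1/3; squaring
-- gives the 9.
junta-size : (p : Subset (suc n)) {f : Vec Bool (suc n) → Bool} → DependsOn p f →
  2 ℕ.* 2 ℕ.^ suc n ℕ.≤ 3 ℕ.* agreements f (MAJ (suc n)) →
  suc (suc n) ℕ.≤ 9 ℕ.* suc ∣ p ∣
junta-size {n} p {f} dep 2N≤3A = ℤ.drop‿+≤+ (ℤ.*-cancelʳ-≤-pos _ _ (N * N) ⦃ N*N-positive ⦄ (begin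
  + suc (suc n) * (N * N)
    ≤⟨ ℤ.*-monoˡ-≤-nonNeg (+ suc (suc n)) (square-mono (ℤ.+≤+ ℕ.z≤n) N≤3c) ⟩
  + suc (suc n) * ((+ 3 * c) * (+ 3 * c))
    ≡⟨ regroup (+ suc (suc n)) c ⟩
  + 9 * (+ suc (suc n) * (c * c))
    ≤⟨ ℤ.*-monoˡ-≤-nonNeg (+ 9) (junta-correlation p dep) ⟩
  + 9 * (+ suc ∣ p ∣ * (N * N))
    ≡⟨ ℤ.*-assoc (+ 9) (+ suc ∣ p ∣) (N * N) ⟨
  + (9 ℕ.* suc ∣ p ∣) * (N * N) ∎))
  where
  open ℤ.≤-Reasoning
  N c : ℤ
  N = + (2 ℕ.^ suc n)
  c = correlation f (majSign (suc n)) 0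
  A = agreements f (MAJ (suc n))

  N*N-positive : ℤ.Positive (N * N)
  N*N-positive = subst ℤ.Positive (ℤ.pos-* (2 ℕ.^ suc n) (2 ℕ.^ suc n))
    (ℤ.positive (ℤ.+<+ (ℕ.*-mono-< (ℕ.m^n>0 2 (suc n)) (ℕ.m^n>0 2 (suc n)))))

  regroup : ∀ x y → x * ((+ 3 * y) * (+ 3 * y)) ≡ + 9 * (x * (y * y))
  regroup = solve-∀

  double : + 2 * + A ≡ N + c
  double = 2*agreements f (MAJ (suc n)) (majSign (suc n)) 0 (λ _ → refl)

  2N≤3A′ : + 2 * N ≤ + 3 * + A
  2N≤3A′ = subst₂ _≤_ (ℤ.pos-* 2 (2 ℕ.^ suc n)) (ℤ.pos-* 3 A) (ℤ.+≤+ 2N≤3A)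

  N≤3c : N ≤ + 3 * c
  N≤3c = begin
    N                                   ≡⟨ lhs N ⟩
    + 2 * (+ 2 * N) - + 3 * N           ≤⟨ ℤ.+-monoˡ-≤ (- (+ 3 * N)) (ℤ.*-monoˡ-≤-nonNeg (+ 2) 2N≤3A′) ⟩
    + 2 * (+ 3 * + A) - + 3 * N         ≡⟨ mid (+ A) N ⟩
    + 3 * (+ 2 * + A) - + 3 * N         ≡⟨ cong (λ z → + 3 * z - + 3 * N) double ⟩
    + 3 * (N + c) - + 3 * N             ≡⟨ rhs N c ⟩
    + 3 * c                             ∎
    where
    lhs : ∀ x → x ≡ + 2 * (+ 2 * x) - + 3 * x
    lhs = solve-∀
    mid : ∀ x y → + 2 * (+ 3 * x) - + 3 * y ≡ + 3 * (+ 2 * x) - + 3 * y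
    mid = solve-∀
    rhs : ∀ x y → + 3 * (x + y) - + 3 * x ≡ + 3 * y
    rhs = solve-∀

-- The variables read by a circuit.

∣p∪q∣≤∣p∣+∣q∣ : (p q : Subset n) → ∣ p ∪ q ∣ ℕ.≤ ∣ p ∣ ℕ.+ ∣ q ∣
∣p∪q∣≤∣p∣+∣q∣ []            []            = ℕ.z≤n
∣p∪q∣≤∣p∣+∣q∣ (inside ∷ p)  (inside ∷ q)  =
  ℕ.s≤s (ℕ.≤-trans (∣p∪q∣≤∣p∣+∣q∣ p q) (ℕ.+-monoʳ-≤ ∣ p ∣ (ℕ.n≤1+n ∣ q ∣)))
∣p∪q∣≤∣p∣+∣q∣ (inside ∷ p)  (outside ∷ q) = ℕ.s≤s (∣p∪q∣≤∣p∣+∣q∣ p q)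
∣p∪q∣≤∣p∣+∣q∣ (outside ∷ p) (inside ∷ q)  =
  subst (suc ∣ p ∪ q ∣ ℕ.≤_) (sym (ℕ.+-suc ∣ p ∣ ∣ q ∣)) (ℕ.s≤s (∣p∪q∣≤∣p∣+∣q∣ p q))
∣p∪q∣≤∣p∣+∣q∣ (outside ∷ p) (outside ∷ q) = ∣p∪q∣≤∣p∣+∣q∣ p q

unionOf : {A : Set} → (A → Subset n) → Vec A r → Subset n
unionOf φ []       = ⊥
unionOf φ (a ∷ as) = φ a ∪ unionOf φ as

∣unionOf∣≤ : ∀ {A : Set} (φ : A → Subset n) {b} → (∀ a → ∣ φ a ∣ ℕ.≤ b) →
  (as : Vec A r) → ∣ unionOf φ as ∣ ℕ.≤ r ℕ.* b
∣unionOf∣≤ {n} φ φ≤b []       = ℕ.≤-reflexive (∣⊥∣≡0 n)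
∣unionOf∣≤     φ φ≤b (a ∷ as) =
  ℕ.≤-trans (∣p∪q∣≤∣p∣+∣q∣ (φ a) _) (ℕ.+-mono-≤ (φ≤b a) (∣unionOf∣≤ φ φ≤b as))

zipWith-cong : ∀ {I : Set} {φ : I → Subset n} {v w : I → Bool} {P : Fin n → Set} →
  (∀ i → (∀ {j} → j ∈ φ i → P j) → v i ≡ w i) →
  (cs : Vec ℕ r) (is : Vec I r) → (∀ {j} → j ∈ unionOf φ is → P j) →
  Vec.zipWith (λ c i → c ℕ.* bit (v i)) cs is ≡ Vec.zipWith (λ c i → c ℕ.* bit (w i)) cs is
zipWith-cong v≡w []       []       _  = refl
zipWith-cong {φ = φ} v≡w (c ∷ cs) (i ∷ is) ∈P = cong₂ _∷_
  (cong (λ b → c ℕ.* bit b) (v≡w i (∈P ∘ p⊆p∪q (unionOf φ is))))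
  (zipWith-cong {φ = φ} v≡w cs is (∈P ∘ q⊆p∪q (φ i) (unionOf φ is)))

-- The input type is left open so that one lemma serves both levels: `φ` is `⁅_⁆` for bottom gates
-- and `gateSupport` for the top gate. `P` stands for equality of two assignments at a variable.
evalGate-cong : ∀ {I : Set} {φ : I → Subset n} {v w : I → Bool} {P : Fin n → Set} →
  (∀ i → (∀ {j} → j ∈ φ i → P j) → v i ≡ w i) →
  (G : Gate k I) → (∀ {j} → j ∈ unionOf φ (Gate.inputs G) → P j) →
  evalGate G v ≡ evalGate G w
evalGate-cong {φ = φ} v≡w G ∈P =
  cong (λ zs → ⌊ threshold ℤ.≤? + Vec.sum zs ⌋) (zipWith-cong {φ = φ} v≡w weights inputs ∈P)
  where open Gate G

length≤sum : {cs : Vec ℕ r} → All (0 ℕ.<_) cs → r ℕ.≤ Vec.sum cs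
length≤sum []         = ℕ.z≤n
length≤sum (0<c ∷ ps) = ℕ.+-mono-≤ 0<c (length≤sum ps)

-- Every weight is at least 1, so the total weight bounds the number of inputs.
fanIn≤k : ∀ {I : Set} (G : Gate k I) → Gate.fanIn G ℕ.≤ k
fanIn≤k G = ℕ.≤-trans (length≤sum weights-positive) weights-bounded
  where open Gate G

gateSupport : Gate k (Fin n) → Subset n
gateSupport G = unionOf ⁅_⁆ (Gate.inputs G)

circuitSupport : Circuit k n → Subset n
circuitSupport C = unionOf gateSupport (Gate.inputs C)

∣gateSupport∣≤k : (G : Gate k (Fin n)) → ∣ gateSupport G ∣ ℕ.≤ k
∣gateSupport∣≤k {k} G = begin
  ∣ gateSupport G ∣     ≤⟨ ∣unionOf∣≤ ⁅_⁆ (ℕ.≤-reflexive ∘ ∣⁅x⁆∣≡1) (Gate.inputs G) ⟩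
  Gate.fanIn G ℕ.* 1    ≡⟨ ℕ.*-identityʳ _ ⟩
  Gate.fanIn G          ≤⟨ fanIn≤k G ⟩
  k                     ∎
  where open ℕ.≤-Reasoning

∣circuitSupport∣≤k² : (C : Circuit k n) → ∣ circuitSupport C ∣ ℕ.≤ k ℕ.* k
∣circuitSupport∣≤k² {k} C =
  ℕ.≤-trans (∣unionOf∣≤ gateSupport ∣gateSupport∣≤k (Gate.inputs C)) (ℕ.*-monoˡ-≤ k (fanIn≤k C))

circuit-dependsOn : (C : Circuit k n) → DependsOn (circuitSupport C) (evalCircuit C)
circuit-dependsOn C x y =
  evalGate-cong {φ = gateSupport} (evalGate-cong {φ = ⁅_⁆} λ i x≡y → x≡y (x∈⁅x⁆ i)) C

size-bound : (C : Circuit k (suc n)) → 0 ℕ.< k →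
  2 ℕ.* 2 ℕ.^ suc n ℕ.≤ 3 ℕ.* agreements (evalCircuit C) (MAJ (suc n)) →
  suc n ℕ.≤ 25 ℕ.* (k ℕ.* k)
size-bound {k} {n} C 0<k agree = begin
  suc n                              ≤⟨ ℕ.n≤1+n _ ⟩
  suc (suc n)                        ≤⟨ junta-size (circuitSupport C) (circuit-dependsOn C) agree ⟩
  -- Positivity of `k` lets `k ℕ.* k` absorb the added 1.
  9 ℕ.* suc ∣ circuitSupport C ∣     ≤⟨ ℕ.*-monoʳ-≤ 9 (ℕ.+-mono-≤ (ℕ.*-mono-≤ 0<k 0<k) (∣circuitSupport∣≤k² C)) ⟩
  9 ℕ.* (k ℕ.* k ℕ.+ k ℕ.* k)        ≡⟨ double (k ℕ.* k) ⟩
  -- Rounding 18 up to the square 25 makes the final constant rational.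
  18 ℕ.* (k ℕ.* k)                   ≤⟨ ℕ.*-monoˡ-≤ (k ℕ.* k) (ℕ.m≤m+n 18 7) ⟩
  25 ℕ.* (k ℕ.* k)                   ∎
  where
  open ℕ.≤-Reasoning
  double : ∀ x → 9 ℕ.* (x ℕ.+ x) ≡ 18 ℕ.* x
  double = ℕ-Solver.solve-∀

-- Passage to rationals and reals.

/-cancel-≤ : ∀ a b c d ⦃ _ : ℕ.NonZero b ⦄ ⦃ _ : ℕ.NonZero d ⦄ →
  + a ℚ./ b ℚ.≤ + c ℚ./ d → a ℕ.* d ℕ.≤ c ℕ.* b
/-cancel-≤ a (suc b) c (suc d) le
  with ℚᵘ.≤-respʳ-≃ (ℚ.toℚᵘ-fromℚᵘ (mkℚᵘ (+ c) d))
         (ℚᵘ.≤-respˡ-≃ (ℚ.toℚᵘ-fromℚᵘ (mkℚᵘ (+ a) b)) (ℚ.toℚᵘ-mono-≤ le))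
... | *≤* ad≤cb = ℤ.drop‿+≤+ (subst₂ _≤_ (sym (ℤ.pos-* a (suc d))) (sym (ℤ.pos-* c (suc b))) ad≤cb)

n≤25*m⇒ : ∀ n m → n ℕ.≤ 25 ℕ.* m →
  (+ 1 ℚ./ 5) ℚ.* (+ 1 ℚ./ 5) ℚ.* (+ n ℚ./ 1) ℚ.≤ + m ℚ./ 1
n≤25*m⇒ n m n≤25m = ℚ.toℚᵘ-cancel-≤ (begin
  -- The product of the two factors 1/5 evaluates to 1/25.
  ℚ.toℚᵘ (+ 1 ℚ./ 25 ℚ.* (+ n ℚ./ 1))             ≃⟨ ℚ.toℚᵘ-homo-* (+ 1 ℚ./ 25) (+ n ℚ./ 1) ⟩
  mkℚᵘ (+ 1) 24 ℚᵘ.* ℚ.toℚᵘ (+ n ℚ./ 1)           ≃⟨ ℚᵘ.*-congˡ {mkℚᵘ (+ 1) 24} (ℚ.toℚᵘ-fromℚᵘ (mkℚᵘ (+ n) 0)) ⟩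
  mkℚᵘ (+ 1) 24 ℚᵘ.* mkℚᵘ (+ n) 0                 ≤⟨ *≤* le ⟩
  mkℚᵘ (+ m) 0                                    ≃⟨ ℚ.toℚᵘ-fromℚᵘ (mkℚᵘ (+ m) 0) ⟨
  ℚ.toℚᵘ (+ m ℚ./ 1)                              ∎)
  where
  open ℚᵘ.≤-Reasoning
  le : (+ 1 * + n) * + 1 ≤ + m * + 25
  le = subst₂ _≤_ (sym (trans (ℤ.*-identityʳ _) (ℤ.*-identityˡ (+ n))))
         (trans (cong +_ (ℕ.*-comm 25 m)) (ℤ.pos-* m 25)) (ℤ.+≤+ n≤25m)

-- If q < 2/3, then 1/3 < 1 - q, and locating `ε` between these yields either 1/3 < ε or ε < 1 - q;
-- each contradicts a hypothesis.
agreement≥2/3 : (ε : ℝ) → ε ≤ℝ fromℚ (+ 1 ℚ./ 3) →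
  ∀ q → 1ℚ ⊖ ε ≤ℝ fromℚ q → + 2 ℚ./ 3 ℚ.≤ q
agreement≥2/3 ε ε≤⅓ q 1-ε≤q = ℚ.≮⇒≥ λ q<⅔ →
  clash (located ε (ℚ.+-monoʳ-< 1ℚ (ℚ.neg-antimono-< q<⅔)))
  where
  clash : lower ε (+ 1 ℚ./ 3) ⊎ upper ε (1ℚ ℚ.- q) → Empty.⊥
  clash (inj₁ l) = ℚ.<-irrefl refl (ε≤⅓ _ l)
  clash (inj₂ u) = ℚ.<-irrefl refl (1-ε≤q q u)

theorem7 : (ε : ℝ) → fromℚ 0ℚ <ℝ ε → ε ≤ℝ fromℚ (+ 1 ℚ./ 3) →
    ∃ λ (c : ℚ) → 0ℚ ℚ.< c ×
    (∀ (n k : ℕ) → 0 ℕ.< n → 0 ℕ.< k →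
    (∃ λ (C : Circuit k n) → 1ℚ ⊖ ε ≤ℝ fromℚ (agreement (evalCircuit C) (MAJ n))) →
    c ℚ.* c ℚ.* (+ n ℚ./ 1) ℚ.≤ + (k ℕ.* k) ℚ./ 1)
-- The witness is the square root of 1/25, from n ≤ 25 k². Agreement enters only through the bound
-- 2/3, so it is the same for every `ε`.
theorem7 ε _ ε≤⅓ = + 1 ℚ./ 5 , ℚ.positive⁻¹ (+ 1 ℚ./ 5) , λ where
  (suc n) k _ 0<k (C , 1-ε≤agreement) →
    let A = agreements (evalCircuit C) (MAJ (suc n))
        agree = /-cancel-≤ 2 3 A (2 ℕ.^ suc n) ⦃ _ ⦄ ⦃ ℕ.m^n≢0 2 (suc n) ⦄
                  (agreement≥2/3 ε ε≤⅓ _ 1-ε≤agreement)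
    in n≤25*m⇒ (suc n) (k ℕ.* k)
         (size-bound C 0<k (subst (2 ℕ.* 2 ℕ.^ suc n ℕ.≤_) (ℕ.*-comm A 3) agree))
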